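{- Up to isomorphism, the only asymmetrical $4$-quasi-transitive critical kernel imperfect digraphs are $\overrightarrow{A}_3$ and $\overrightarrow{C}_5$. That is, an asymmetrical $4$-quasi-transitive digraph $D$ is critical kernel imperfect if and only if $D\cong\overrightarrow{A}_3$ or $D\cong\overrightarrow{C}_5$.
   Context: All digraphs are finite, with no loops and no multiple arcs (a pair of opposite arcs $(u,v),(v,u)$ is allowed). A digraph is asymmetrical if for every arc $(u,v)$, $(v,u)$ is not an arc. A kernel of $D$ is a set $K\subseteq V(D)$ that is independent (no arcs between its vertices) and absorbent (for every $u\in V(D)\setminus K$ there is $v\in K$ with $(u,v)\in A(D)$). $D$ is critical kernel imperfect if $D$ has no kernel but every proper induced subdigraph of $D$ has a kernel. A $k$-path is a directed path (distinct vertices) of length $k$. $D$ is $4$-quasi-transitive if for all vertices $u,v$, the existence of a $4$-path from $u$ to $v$ implies that $(u,v)\in A(D)$ or $(v,u)\in A(D)$. $\overrightarrow{C}_n$ is the directed cycle on $\mathbb{Z}_n$ with arcs $(i,i+1)$; $\overrightarrow{A}_n$ ($n\ge 3$) is the digraph on $\mathbb{Z}_n$ with arcs $(i,j)$ for $j-i\in\{1,\dots,n-2\}$ (so $\overrightarrow{A}_3=\overrightarrow{C}_3$). -}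

module Defs where

open import Data.Fin.Base using (Fin; zero; suc; toℕ; fromℕ; inject₁)
open import Data.Fin.Properties using (toℕ<n; toℕ≤n)
open import Data.Fin.Subset using (Subset; inside; outside; _∈_; _∉_; _⊂_; ⊤; ∣_∣)
open import Data.Nat.Base
open import Data.Nat.DivMod using (_%_; n%n≡0; m<n⇒m%n≡m)
open import Data.Nat.Properties using (_≟_; _≤?_; ≤-trans; m≤n⇒m<n∨m≡n; m+[n∸m]≡n; 1+n≢n)
open import Data.Product.Base using (Σ-syntax; ∃; ∃-syntax; _×_; _,_)
open import Data.Sum.Base using (_⊎_; inj₁; inj₂)
open import Data.Vec.Base using ([]; _∷_)
open import Function.Base using (_on_)
open import Function.Bundles using (_↔_; _⇔_; module Inverse)
open import Function.Definitions using (Injective)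
open import Level using (0ℓ)
open import Relation.Binary.Core using (Rel)
open import Relation.Binary.Definitions using (Asymmetric; Irreflexive; Decidable)
open import Relation.Binary.PropositionalEquality
  using (_≡_; refl; sym; trans; cong; subst)
open import Relation.Nullary.Decidable.Core using (_×-dec_)
open import Relation.Nullary.Negation.Core using (¬_)

-- Arc is a relation, so there are no multiple arcs; opposite arcs are allowed.
record Digraph : Set₁ where
  field
    order    : ℕ
    Arc      : Rel (Fin order) 0ℓ
    loopless : Irreflexive _≡_ Arc
    arc?     : Decidable Arc

  Vertex : Set
  Vertex = Fin order

open Digraph public using (order; Vertex; Arc)

infix 4 _≅_

_≅_ : Digraph → Digraph → Set
D ≅ E = Σ[ f ∈ Vertex D ↔ Vertex E ]
  (∀ u v → Arc D u v ⇔ Arc E (Inverse.to f u) (Inverse.to f v))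

Asymmetrical : Digraph → Set
Asymmetrical D = Asymmetric (Arc D)

-- The increasing enumeration of the elements of S.
members : ∀ {n} (S : Subset n) → Fin ∣ S ∣ → Fin n
members (inside  ∷ S) zero    = zero
members (inside  ∷ S) (suc i) = suc (members S i)
members (outside ∷ S) i       = suc (members S i)

-- The subdigraph induced by S, its vertices renumbered along members S.
induced : (D : Digraph) → Subset (order D) → Digraph
induced D S = record
  { order    = ∣ S ∣
  ; Arc      = Arc D on members S
  ; loopless = λ u≡v → Digraph.loopless D (cong (members S) u≡v)
  ; arc?     = λ u v → Digraph.arc? D (members S u) (members S v)
  }

record IsKernel (D : Digraph) (K : Subset (order D)) : Set where
  field
    independent : ∀ {u v} → u ∈ K → v ∈ K → ¬ Arc D u v
    absorbent   : ∀ {u} → u ∉ K → ∃[ v ] v ∈ K × Arc D u v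

HasKernel : Digraph → Set
HasKernel D = ∃ (IsKernel D)

CriticalKernelImperfect : Digraph → Set
CriticalKernelImperfect D =
  ¬ HasKernel D × (∀ (S : Subset (order D)) → S ⊂ ⊤ → HasKernel (induced D S))

record Path (D : Digraph) (k : ℕ) (u v : Vertex D) : Set where
  field
    vertex   : Fin (suc k) → Vertex D
    distinct : Injective _≡_ _≡_ vertex
    start    : vertex zero ≡ u
    end      : vertex (fromℕ k) ≡ v
    arcs     : ∀ (i : Fin k) → Arc D (vertex (inject₁ i)) (vertex (suc i))

QuasiTransitive : ℕ → Digraph → Set
QuasiTransitive k D = ∀ u v → Path D k u v → Arc D u v ⊎ Arc D v u

-- Elements of ℤₙ are represented by their residues in Fin n.
C⃗ : (n : ℕ) → 2 ≤ n → Digraph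
C⃗ n 2≤n = record
  { order    = n
  ; Arc      = λ i j → toℕ j ≡ suc (toℕ i) % n
  ; loopless = λ { {i} refl i≡1+i → no-loop i i≡1+i }
  ; arc?     = λ i j → toℕ j ≟ suc (toℕ i) % n
  }
  where
  instance
    n≢0 : NonZero n
    n≢0 = >-nonZero (≤-trans (s≤s z≤n) 2≤n)

  no-loop : (i : Fin n) → ¬ (toℕ i ≡ suc (toℕ i) % n)
  no-loop i eq with m≤n⇒m<n∨m≡n (toℕ<n i)
  ... | inj₁ 1+i<n = 1+n≢n (sym (trans eq (m<n⇒m%n≡m 1+i<n)))
  ... | inj₂ 1+i≡n with subst (2 ≤_) (trans (sym 1+i≡n) (cong suc i≡0)) 2≤n
    where
    i≡0 : toℕ i ≡ 0
    i≡0 = trans eq (trans (cong (_% n) 1+i≡n) (n%n≡0 n))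
  ...   | s≤s ()

-- The representative of j − i in {0, …, n − 1}.
difference : ∀ {n} → .{{NonZero n}} → Fin n → Fin n → ℕ
difference {n} j i = (toℕ j + (n ∸ toℕ i)) % n

A⃗ : (n : ℕ) → 3 ≤ n → Digraph
A⃗ n 3≤n = record
  { order    = n
  ; Arc      = λ i j → 1 ≤ difference j i × difference j i ≤ n ∸ 2
  ; loopless = λ { {i} refl (1≤d , _) → no-loop i 1≤d }
  ; arc?     = λ i j → (1 ≤? difference j i) ×-dec (difference j i ≤? n ∸ 2)
  }
  where
  instance
    n≢0 : NonZero n
    n≢0 = >-nonZero (≤-trans (s≤s z≤n) 3≤n)

  no-loop : (i : Fin n) → ¬ (1 ≤ difference i i)
  no-loop i 1≤d with subst (1 ≤_) d≡0 1≤d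
    where
    d≡0 : difference i i ≡ 0
    d≡0 = trans (cong (_% n) (m+[n∸m]≡n (toℕ≤n i))) (n%n≡0 n)
  ... | ()

{-# OPTIONS --safe #-}

-- Suppose D is critical kernel imperfect and has no directed triangle. If v → w and K is a
-- kernel of D − v, then (K ∖ N⁻(v)) ∪ {v} is independent but not a kernel of D; a vertex u
-- which it does not absorb lies on a closed walk v → w → k′ → u → k → v with k, k′ ∈ K, and in
-- this pentagon only the chords w → u and k → w are possible, not both. Without a chord the
-- pentagon is all of D. Either chord yields an induced 4-cycle a → b → c → d → a
-- with a further vertex x, c → x → d. Then c is the only out-neighbour of b, so {b , d}
-- absorbs its out-neighbours and extends to a kernel of D.

module Submission where

open import Defs
open import Data.Empty using (⊥; ⊥-elim)
open import Data.Fin.Base using (Fin; zero; suc)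
open import Data.Fin.Patterns using (0F; 1F; 2F; 3F; 4F)
open import Data.Fin.Properties using (_≟_; any?; all?)
open import Data.Fin.Subset using (Subset; inside; outside; _∈_; _∉_; _⊂_; ⊤)
open import Data.Fin.Subset.Properties using (_∈?_; _⊂?_; anySubset?; ∈⊤; ⊆⊤)
open import Data.Nat.Base using (z≤n; s≤s)
open import Data.Nat.Properties using (≤-refl)
open import Data.Product.Base using (∃; ∃-syntax; _×_; _,_; proj₁; proj₂)
open import Data.Sum.Base using (_⊎_; inj₁; inj₂; [_,_]′; swap)
open import Data.Unit.Base using (tt)
open import Data.Vec.Base using ([]; _∷_; lookup; tabulate; here; there)
open import Data.Vec.Properties using (lookup∘tabulate; lookup⇒[]=; []=⇒lookup)
open import Function.Base using (_∘_; id)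
open import Function.Bundles using (_⇔_; mk⇔; mk↔ₛ′; module Equivalence; module Inverse)
open import Function.Definitions using (Injective)
open import Level using (0ℓ)
open import Relation.Binary.PropositionalEquality
  using (_≡_; _≢_; refl; sym; trans; cong; subst; subst₂)
open import Relation.Nullary.Decidable
  using (Dec; yes; no; does; map′; dec-true; decidable-stable; from-yes;
         ¬?; _×-dec_; _⊎-dec_; _→-dec_)
open import Relation.Nullary.Negation.Core using (¬_; contradiction)
open import Relation.Unary using (Pred; Decidable; U)
open import Relation.Unary.Properties using (U?)

-- Adjacency, and kernels of induced subdigraphs as sets of vertices.

Adjacent : (D : Digraph) → Vertex D → Vertex D → Set
Adjacent D u v = Arc D u v ⊎ Arc D v u

-- A kernel of the subdigraph induced by P, given as a set of vertices of D: this avoids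
-- renumbering.
record KernelOn (D : Digraph) (P : Pred (Vertex D) 0ℓ) : Set₁ where
  field
    K           : Pred (Vertex D) 0ℓ
    K?          : Decidable K
    K⊆P         : ∀ {u} → K u → P u
    independent : ∀ {u v} → K u → K v → ¬ Arc D u v
    absorbent   : ∀ {u} → P u → ¬ K u → ∃[ v ] K v × Arc D u v

module _ {n} {P : Pred (Fin n) 0ℓ} (P? : Decidable P) where

  comprehension : Subset n
  comprehension = tabulate (does ∘ P?)

  ∈-comprehension⁺ : ∀ {i} → P i → i ∈ comprehension
  ∈-comprehension⁺ {i} p =
    lookup⇒[]= i _ (trans (lookup∘tabulate (does ∘ P?) i) (dec-true (P? i) p))

  ∈-comprehension⁻ : ∀ {i} → i ∈ comprehension → P i
  ∈-comprehension⁻ {i} i∈ with P? i | trans (sym (lookup∘tabulate (does ∘ P?) i)) ([]=⇒lookup i∈)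
  ... | yes p | _  = p
  ... | no  _ | ()

members-∈ : ∀ {n} (S : Subset n) i → members S i ∈ S
members-∈ (inside  ∷ S) zero    = here
members-∈ (inside  ∷ S) (suc i) = there (members-∈ S i)
members-∈ (outside ∷ S) i       = there (members-∈ S i)

members-surjective : ∀ {n} (S : Subset n) {x} → x ∈ S → ∃[ i ] members S i ≡ x
members-surjective (inside  ∷ S) here       = zero , refl
members-surjective (inside  ∷ S) (there x∈) with i , eq ← members-surjective S x∈ =
  suc i , cong suc eq
members-surjective (outside ∷ S) (there x∈) with i , eq ← members-surjective S x∈ =
  i , cong suc eq

module _ (D : Digraph) where

  hasKernel⇒kernelOn : HasKernel D → KernelOn D U
  hasKernel⇒kernelOn (K , kernel) = record
    { K           = _∈ K
    ; K?          = _∈? K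
    ; K⊆P         = λ _ → tt
    ; independent = IsKernel.independent kernel
    ; absorbent   = λ _ → IsKernel.absorbent kernel
    }

  kernelOn⇒hasKernel : KernelOn D U → HasKernel D
  kernelOn⇒hasKernel κ = comprehension K? , record
    { independent = λ u∈ v∈ → independent (∈-comprehension⁻ K? u∈) (∈-comprehension⁻ K? v∈)
    ; absorbent   = λ u∉ → let v , v∈ , uv = absorbent tt (u∉ ∘ ∈-comprehension⁺ K?)
                           in v , ∈-comprehension⁺ K? v∈ , uv
    }
    where open KernelOn κ

  induced⇒kernelOn : ∀ S → HasKernel (induced D S) → KernelOn D (_∈ S)
  induced⇒kernelOn S (K , kernel) = record
    { K           = λ x → ∃[ i ] i ∈ K × members S i ≡ x
    ; K?          = λ x → any? λ i → (i ∈? K) ×-dec (members S i ≟ x)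
    ; K⊆P         = λ { (i , _ , refl) → members-∈ S i }
    ; independent = λ { (_ , i∈ , refl) (_ , j∈ , refl) → IsKernel.independent kernel i∈ j∈ }
    ; absorbent   = absorbent
    }
    where
    absorbent : ∀ {u} → u ∈ S → ¬ (∃[ i ] i ∈ K × members S i ≡ u) →
                ∃[ v ] (∃[ i ] i ∈ K × members S i ≡ v) × Arc D u v
    absorbent u∈ u∉ with i , refl ← members-surjective S u∈
      with j , j∈ , ij ← IsKernel.absorbent kernel (λ i∈ → u∉ (i , i∈ , refl))
      = members S j , (j , j∈ , refl) , ij

  kernelOn⇒induced : ∀ S → KernelOn D (_∈ S) → HasKernel (induced D S)
  kernelOn⇒induced S κ = comprehension K∘S? , record
    { independent = λ u∈ v∈ → independent (∈-comprehension⁻ K∘S? u∈) (∈-comprehension⁻ K∘S? v∈)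
    ; absorbent   = absorbs
    }
    where
    open KernelOn κ
    K∘S? : Decidable (K ∘ members S)
    K∘S? i = K? (members S i)

    absorbs : ∀ {i} → i ∉ comprehension K∘S? →
              ∃[ j ] j ∈ comprehension K∘S? × Arc D (members S i) (members S j)
    absorbs {i} i∉ with v , v∈ , iv ← absorbent (members-∈ S i) (i∉ ∘ ∈-comprehension⁺ K∘S?)
      with j , refl ← members-surjective S (K⊆P v∈)
      = j , ∈-comprehension⁺ K∘S? v∈ , iv

-- Criticality in the form used below: the missed vertex `v` makes the subset cut out by `P` proper.
proper⇒kernelOn : ∀ {D} → CriticalKernelImperfect D →
                  ∀ {P} → Decidable P → ∀ {v} → ¬ P v → KernelOn D P
proper⇒kernelOn {D} (_ , critical) {P} P? {v} ¬Pv = record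
  { K           = K
  ; K?          = K?
  ; K⊆P         = ∈-comprehension⁻ P? ∘ K⊆P
  ; independent = independent
  ; absorbent   = absorbent ∘ ∈-comprehension⁺ P?
  }
  where
  S⊂⊤ : comprehension P? ⊂ ⊤
  S⊂⊤ = ⊆⊤ , v , ∈⊤ , ¬Pv ∘ ∈-comprehension⁻ P?
  open KernelOn (induced⇒kernelOn D (comprehension P?) (critical (comprehension P?) S⊂⊤))

-- Transport of kernels along maps that preserve and reflect arcs.

module _ {D E : Digraph} (f : Vertex E → Vertex D)
         (arc⇔ : ∀ u v → Arc E u v ⇔ Arc D (f u) (f v)) where

  pullback : ∀ {P Q} → (∀ {u} → Q u ⇔ P (f u)) → (∀ {v} → P v → ∃[ u ] f u ≡ v) →
             KernelOn D P → KernelOn E Q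
  pullback {P} {Q} Q⇔P P⊆f κ = record
    { K           = K ∘ f
    ; K?          = K? ∘ f
    ; K⊆P         = Equivalence.from Q⇔P ∘ K⊆P
    ; independent = λ u∈ v∈ uv → independent u∈ v∈ (Equivalence.to (arc⇔ _ _) uv)
    ; absorbent   = absorbs
    }
    where
    open KernelOn κ
    absorbs : ∀ {u} → Q u → ¬ K (f u) → ∃[ v ] K (f v) × Arc E u v
    absorbs Qu u∉ with v , v∈ , uv ← absorbent (Equivalence.to Q⇔P Qu) u∉
      with w , refl ← P⊆f (K⊆P v∈)
      = w , v∈ , Equivalence.from (arc⇔ _ _) uv

  -- A proper image of f would have a kernel, hence E would.
  critical⇒≅ : CriticalKernelImperfect D → ¬ HasKernel E → Injective _≡_ _≡_ f → D ≅ E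
  critical⇒≅ crit ¬kernel f-injective =
    mk↔ₛ′ g f (λ u → f-injective (f∘g (f u))) f∘g
    , λ u v → mk⇔
        (λ uv → Equivalence.from (arc⇔ _ _) (subst₂ (Arc D) (sym (f∘g u)) (sym (f∘g v)) uv))
        (λ uv → subst₂ (Arc D) (f∘g u) (f∘g v) (Equivalence.to (arc⇔ _ _) uv))
    where
    Image : Pred (Vertex D) 0ℓ
    Image v = ∃[ u ] f u ≡ v

    Image? : Decidable Image
    Image? v = any? λ u → f u ≟ v

    ¬proper : ∀ v → ¬ ¬ Image v
    ¬proper v v∉ = ¬kernel (kernelOn⇒hasKernel E
      (pullback (mk⇔ (λ _ → _ , refl) (λ _ → tt)) id (proper⇒kernelOn crit Image? v∉)))

    preimage : ∀ v → Image v
    preimage v = decidable-stable (Image? v) (¬proper v)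

    g : Vertex D → Vertex E
    g = proj₁ ∘ preimage

    f∘g : ∀ v → f (g v) ≡ v
    f∘g = proj₂ ∘ preimage

critical-resp-≅ : ∀ {D E} → D ≅ E → CriticalKernelImperfect E → CriticalKernelImperfect D
critical-resp-≅ {D} {E} (iso , arc⇔) crit@(¬kernel , _) =
  (λ kernel → ¬kernel (kernelOn⇒hasKernel E
    (pullback from from-arc⇔ (mk⇔ id id) (λ {v} _ → to v , strictlyInverseʳ v)
      (hasKernel⇒kernelOn D kernel))))
  , λ { S (_ , v , _ , v∉S) → kernelOn⇒induced D S
    (pullback to arc⇔
      (λ {u} → mk⇔ (subst (_∈ S) (sym (strictlyInverseʳ u))) (subst (_∈ S) (strictlyInverseʳ u)))
      (λ {v} _ → from v , strictlyInverseˡ v)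
      -- The image of `S` under `to` is proper because it misses `to v`.
      (proper⇒kernelOn crit (λ e → from e ∈? S)
        (λ v∈ → v∉S (subst (_∈ S) (strictlyInverseʳ v) v∈)))) }
  where
  open Inverse iso using (to; from; strictlyInverseˡ; strictlyInverseʳ)
  from-arc⇔ : ∀ u v → Arc E u v ⇔ Arc D (from u) (from v)
  from-arc⇔ u v = mk⇔
    (λ uv → Equivalence.from (arc⇔ _ _)
      (subst₂ (Arc E) (sym (strictlyInverseˡ u)) (sym (strictlyInverseˡ v)) uv))
    (λ uv → subst₂ (Arc E) (strictlyInverseˡ u) (strictlyInverseˡ v)
      (Equivalence.to (arc⇔ _ _) uv))

-- Criticality of the two digraphs by exhaustive search.

isKernel? : ∀ D → Decidable (IsKernel D)
isKernel? D K = map′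
  (λ (i , a) → record { independent = λ {u} {v} u∈ v∈ uv → i u v u∈ v∈ uv ; absorbent = a _ })
  (λ κ → (λ _ _ → IsKernel.independent κ) , (λ _ → IsKernel.absorbent κ))
  ((all? λ u → all? λ v → (u ∈? K) →-dec ((v ∈? K) →-dec ¬? (arc? u v)))
    ×-dec (all? λ u → ¬? (u ∈? K) →-dec (any? λ v → (v ∈? K) ×-dec arc? u v)))
  where open Digraph D using (arc?)

hasKernel? : ∀ D → Dec (HasKernel D)
hasKernel? D = anySubset? (isKernel? D)

critical? : ∀ D → Dec (CriticalKernelImperfect D)
critical? D = ¬? (hasKernel? D) ×-dec map′
  (λ ¬bad S S⊂⊤ → decidable-stable (hasKernel? (induced D S)) λ ¬kernel → ¬bad (S , S⊂⊤ , ¬kernel))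
  (λ good (S , S⊂⊤ , ¬kernel) → ¬kernel (good S S⊂⊤))
  (¬? (anySubset? λ S → (S ⊂? ⊤) ×-dec ¬? (hasKernel? (induced D S))))

A⃗₃ C⃗₅ : Digraph
A⃗₃ = A⃗ 3 ≤-refl
C⃗₅ = C⃗ 5 (s≤s (s≤s z≤n))

A⃗₃-critical : CriticalKernelImperfect A⃗₃
A⃗₃-critical = from-yes (critical? A⃗₃)

C⃗₅-critical : CriticalKernelImperfect C⃗₅
C⃗₅-critical = from-yes (critical? C⃗₅)

-- Recognition of the two digraphs from a triangle or a pentagon.

TwinFree : Digraph → Set
TwinFree E = ∀ u v → u ≡ v ⊎ ∃[ w ] Arc E u w × ¬ Arc E v w

twinFree? : ∀ E → Dec (TwinFree E)
twinFree? E = all? λ u → all? λ v → (u ≟ v) ⊎-dec (any? λ w → arc? u w ×-dec ¬? (arc? v w))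
  where open Digraph E using (arc?)

module _ {D : Digraph} (asym : Asymmetrical D) (crit : CriticalKernelImperfect D) where

  -- Missing arcs matter only for distinct pairs not adjacent in `E`: looplessness and asymmetry
  -- settle the others. Twin-freeness then yields injectivity, since `f u ≡ f v` would turn every
  -- arc `u → w` into an arc `v → w`.
  inducedCopy⇒≅ : ∀ {E} → CriticalKernelImperfect E → TwinFree E → (f : Vertex E → Vertex D) →
                  (∀ u v → Arc E u v → Arc D (f u) (f v)) →
                  (∀ u v → (u ≡ v ⊎ Adjacent E u v) ⊎ ¬ Adjacent D (f u) (f v)) →
                  D ≅ E
  inducedCopy⇒≅ {E} (¬kernel , _) twinFree f preserves reflects =
    critical⇒≅ f arc⇔ crit ¬kernel injective
    where
    reflectsArc : ∀ u v → Arc D (f u) (f v) → Arc E u v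
    reflectsArc u v uv with reflects u v
    ... | inj₁ (inj₁ refl)      = contradiction uv (Digraph.loopless D refl)
    ... | inj₁ (inj₂ (inj₁ uv′)) = uv′
    ... | inj₁ (inj₂ (inj₂ vu))  = contradiction (preserves v u vu) (asym uv)
    ... | inj₂ ¬adj              = contradiction (inj₁ uv) ¬adj

    arc⇔ : ∀ u v → Arc E u v ⇔ Arc D (f u) (f v)
    arc⇔ u v = mk⇔ (preserves u v) (reflectsArc u v)

    injective : Injective _≡_ _≡_ f
    injective {u} {v} fu≡fv with twinFree u v
    ... | inj₁ u≡v             = u≡v
    ... | inj₂ (w , uw , ¬vw) =
      contradiction (reflectsArc v w (subst (λ x → Arc D x (f w)) fu≡fv (preserves u w uw))) ¬vw

  triangle⇒≅A⃗₃ : ∀ {a b c} → Arc D a b → Arc D b c → Arc D c a → D ≅ A⃗₃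
  triangle⇒≅A⃗₃ {a} {b} {c} ab bc ca =
    inducedCopy⇒≅ A⃗₃-critical (from-yes (twinFree? A⃗₃)) f preserves (λ u v → inj₁ (tournament u v))
    where
    f : Fin 3 → Vertex D
    f = lookup (a ∷ b ∷ c ∷ [])

    next : Fin 3 → Fin 3
    next = lookup (1F ∷ 2F ∷ 0F ∷ [])

    arcsToNext : ∀ u v → Arc A⃗₃ u v → v ≡ next u
    arcsToNext = from-yes (all? λ u → all? λ v → Digraph.arc? A⃗₃ u v →-dec (v ≟ next u))

    tournament : ∀ u v → u ≡ v ⊎ Adjacent A⃗₃ u v
    tournament = from-yes (all? λ u → all? λ v →
      (u ≟ v) ⊎-dec (Digraph.arc? A⃗₃ u v ⊎-dec Digraph.arc? A⃗₃ v u))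

    step : ∀ u → Arc D (f u) (f (next u))
    step 0F = ab
    step 1F = bc
    step 2F = ca

    preserves : ∀ u v → Arc A⃗₃ u v → Arc D (f u) (f v)
    preserves u v uv with refl ← arcsToNext u v uv = step u

  pentagon⇒≅C⃗₅ : ∀ {a b c d e} →
    Arc D a b → Arc D b c → Arc D c d → Arc D d e → Arc D e a →
    ¬ Adjacent D a c → ¬ Adjacent D b d → ¬ Adjacent D c e → ¬ Adjacent D d a → ¬ Adjacent D e b →
    D ≅ C⃗₅
  pentagon⇒≅C⃗₅ {a} {b} {c} {d} {e} ab bc cd de ea ¬ac ¬bd ¬ce ¬da ¬eb =
    inducedCopy⇒≅ C⃗₅-critical (from-yes (twinFree? C⃗₅)) f preserves reflects
    where
    f : Fin 5 → Vertex D
    f = lookup (a ∷ b ∷ c ∷ d ∷ e ∷ [])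

    next : Fin 5 → Fin 5
    next = lookup (1F ∷ 2F ∷ 3F ∷ 4F ∷ 0F ∷ [])

    arcsToNext : ∀ u v → Arc C⃗₅ u v → v ≡ next u
    arcsToNext = from-yes (all? λ u → all? λ v → Digraph.arc? C⃗₅ u v →-dec (v ≟ next u))

    -- Two distinct non-adjacent vertices of the 5-cycle are two steps apart in one direction, so
    -- the five excluded chords cover all such pairs.
    distance : ∀ u v → (u ≡ v ⊎ Adjacent C⃗₅ u v) ⊎ (v ≡ next (next u) ⊎ u ≡ next (next v))
    distance = from-yes (all? λ u → all? λ v →
      ((u ≟ v) ⊎-dec (Digraph.arc? C⃗₅ u v ⊎-dec Digraph.arc? C⃗₅ v u))
        ⊎-dec ((v ≟ next (next u)) ⊎-dec (u ≟ next (next v))))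

    step : ∀ u → Arc D (f u) (f (next u))
    step 0F = ab
    step 1F = bc
    step 2F = cd
    step 3F = de
    step 4F = ea

    ¬skip : ∀ u → ¬ Adjacent D (f u) (f (next (next u)))
    ¬skip 0F = ¬ac
    ¬skip 1F = ¬bd
    ¬skip 2F = ¬ce
    ¬skip 3F = ¬da
    ¬skip 4F = ¬eb

    preserves : ∀ u v → Arc C⃗₅ u v → Arc D (f u) (f v)
    preserves u v uv with refl ← arcsToNext u v uv = step u

    reflects : ∀ u v → (u ≡ v ⊎ Adjacent C⃗₅ u v) ⊎ ¬ Adjacent D (f u) (f v)
    reflects u v with distance u v
    ... | inj₁ close       = inj₁ close
    ... | inj₂ (inj₁ refl) = inj₂ (¬skip u)
    ... | inj₂ (inj₂ refl) = inj₂ (¬skip v ∘ swap)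

-- Unabsorbed vertices and semikernels.

module _ {D : Digraph} where

  open Digraph D using (arc?; loopless)

  Absorbed : Pred (Vertex D) 0ℓ → Pred (Vertex D) 0ℓ
  Absorbed S u = ∃[ s ] S s × Arc D u s

  absorbed? : ∀ {S} → Decidable S → Decidable (Absorbed S)
  absorbed? S? u = any? λ s → S? s ×-dec arc? u s

  unabsorbed : ¬ HasKernel D → ∀ {S} → Decidable S → (∀ {u v} → S u → S v → ¬ Arc D u v) →
               ∃[ u ] ¬ S u × ¬ Absorbed S u
  unabsorbed ¬kernel {S} S? independent
    with any? (λ u → ¬? (S? u) ×-dec ¬? (absorbed? S? u))
  ... | yes u∃  = u∃
  ... | no ¬u∃ = contradiction (kernelOn⇒hasKernel D record
    { K           = S
    ; K?          = S?
    ; K⊆P         = λ _ → tt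
    ; independent = independent
    ; absorbent   = λ {u} _ u∉ → decidable-stable (absorbed? S? u) λ ¬abs → ¬u∃ (u , u∉ , ¬abs)
    }) ¬kernel

  -- S together with a kernel of the vertices neither in S nor absorbed by S is a kernel.
  ¬semikernel : CriticalKernelImperfect D → ∀ {S} → Decidable S → ∃ S →
                (∀ {u v} → S u → S v → ¬ Arc D u v) →
                ¬ (∀ {u v} → S u → Arc D u v → Absorbed S v)
  ¬semikernel crit {S} S? (s , s∈) independent returns =
    let u , u∉ , ¬abs = unabsorbed (proj₁ crit) S∪K? S∪K-independent in
    u∉ (inj₂ (decidable-stable (K? u) λ u∉K →
      let v , v∈ , uv = absorbent ((u∉ ∘ inj₁) , λ (t , t∈ , ut) → ¬abs (t , inj₁ t∈ , ut)) u∉K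
      in ¬abs (v , inj₂ v∈ , uv)))
    where
    Rest : Pred (Vertex D) 0ℓ
    Rest u = ¬ S u × ¬ Absorbed S u

    open KernelOn (proper⇒kernelOn crit {Rest} (λ u → ¬? (S? u) ×-dec ¬? (absorbed? S? u))
                     {s} (λ (s∉ , _) → s∉ s∈))
      renaming (independent to K-independent)

    S∪K? : Decidable (λ u → S u ⊎ K u)
    S∪K? u = S? u ⊎-dec K? u

    S∪K-independent : ∀ {u v} → S u ⊎ K u → S v ⊎ K v → ¬ Arc D u v
    S∪K-independent (inj₁ u∈) (inj₁ v∈) uv = independent u∈ v∈ uv
    -- `Rest` has no vertex absorbed by `S`: an arc out of `S` ends in an absorbed vertex by
    -- `returns`, an arc into `S` starts in one.
    S∪K-independent (inj₁ u∈) (inj₂ v∈) uv = proj₂ (K⊆P v∈) (returns u∈ uv)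
    S∪K-independent (inj₂ u∈) (inj₁ v∈) uv = proj₂ (K⊆P u∈) (_ , v∈ , uv)
    S∪K-independent (inj₂ u∈) (inj₂ v∈) uv = K-independent u∈ v∈ uv

-- Triangle-free case: pentagons and their chords.

module TriangleFree {D : Digraph} (asym : Asymmetrical D) (quasi : QuasiTransitive 4 D)
                    (crit : CriticalKernelImperfect D)
                    (¬triangle : ∀ {a b c} → Arc D a b → Arc D b c → ¬ Arc D c a) where

  open Digraph D using (arc?; loopless)

  -- Without loops, digons and triangles only the ends of a walk of length 4 can coincide.
  walk₄⇒adjacent : ∀ {a b c d e} → Arc D a b → Arc D b c → Arc D c d → Arc D d e → a ≢ e →
                   Adjacent D a e
  walk₄⇒adjacent {a} {b} {c} {d} {e} ab bc cd de a≢e = quasi a e record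
    { vertex   = vertex
    ; distinct = λ {i} {j} → distinct i j
    ; start    = refl
    ; end      = refl
    ; arcs     = λ { 0F → ab ; 1F → bc ; 2F → cd ; 3F → de }
    }
    where
    vertex : Fin 5 → Vertex D
    vertex = lookup (a ∷ b ∷ c ∷ d ∷ e ∷ [])

    ≢₁ : ∀ {u v} → Arc D u v → u ≢ v
    ≢₁ uv refl = loopless refl uv

    ≢₂ : ∀ {u v w} → Arc D u v → Arc D v w → u ≢ w
    ≢₂ uv vw refl = asym uv vw

    ≢₃ : ∀ {u v w x} → Arc D u v → Arc D v w → Arc D w x → u ≢ x
    ≢₃ uv vw wx refl = ¬triangle uv vw wx

    distinct : ∀ i j → vertex i ≡ vertex j → i ≡ j
    distinct 0F 0F _  = refl
    distinct 0F 1F eq = contradiction eq (≢₁ ab)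
    distinct 0F 2F eq = contradiction eq (≢₂ ab bc)
    distinct 0F 3F eq = contradiction eq (≢₃ ab bc cd)
    distinct 0F 4F eq = contradiction eq a≢e
    distinct 1F 1F _  = refl
    distinct 1F 2F eq = contradiction eq (≢₁ bc)
    distinct 1F 3F eq = contradiction eq (≢₂ bc cd)
    distinct 1F 4F eq = contradiction eq (≢₃ bc cd de)
    distinct 2F 2F _  = refl
    distinct 2F 3F eq = contradiction eq (≢₁ cd)
    distinct 2F 4F eq = contradiction eq (≢₂ cd de)
    distinct 3F 3F _  = refl
    distinct 3F 4F eq = contradiction eq (≢₁ de)
    distinct 4F 4F _  = refl
    distinct 1F 0F eq = contradiction (sym eq) (≢₁ ab)
    distinct 2F 0F eq = contradiction (sym eq) (≢₂ ab bc)
    distinct 3F 0F eq = contradiction (sym eq) (≢₃ ab bc cd)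
    distinct 4F 0F eq = contradiction (sym eq) a≢e
    distinct 2F 1F eq = contradiction (sym eq) (≢₁ bc)
    distinct 3F 1F eq = contradiction (sym eq) (≢₂ bc cd)
    distinct 4F 1F eq = contradiction (sym eq) (≢₃ bc cd de)
    distinct 3F 2F eq = contradiction (sym eq) (≢₁ cd)
    distinct 4F 2F eq = contradiction (sym eq) (≢₂ cd de)
    distinct 4F 3F eq = contradiction (sym eq) (≢₁ de)

  -- Of the five chords of this 5-cycle, only those joining `w` to `u` and `k` to `w` are left
  -- undecided.
  record PentagonThrough (v w : Vertex D) : Set where
    field
      k′ u k : Vertex D
      wk′    : Arc D w k′
      k′u    : Arc D k′ u
      uk     : Arc D u k
      kv     : Arc D k v
      ¬uv    : ¬ Adjacent D u v
      ¬k′v   : ¬ Adjacent D k′ v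
      ¬k′k   : ¬ Adjacent D k′ k

  module _ {v w} (vw : Arc D v w) where

    open KernelOn (proper⇒kernelOn crit {_≢ v} (λ u → ¬? (u ≟ v)) {v} (λ v≢v → v≢v refl))

    private
      -- Otherwise `K` would absorb `v` too and be a kernel of `D`.
      K-isolated : ∀ {k} → K k → ¬ Arc D v k
      K-isolated {k} k∈ vk with x , x∉ , ¬abs ← unabsorbed (proj₁ crit) K? independent
        with x ≟ v
      ... | yes refl = ¬abs (k , k∈ , vk)
      ... | no x≢v  = ¬abs (absorbent x≢v x∉)

      S : Pred (Vertex D) 0ℓ
      S x = (K x × ¬ Arc D x v) ⊎ x ≡ v

      S? : Decidable S
      S? x = (K? x ×-dec ¬? (arc? x v)) ⊎-dec (x ≟ v)

      S-independent : ∀ {x y} → S x → S y → ¬ Arc D x y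
      S-independent (inj₁ (x∈ , _))  (inj₁ (y∈ , _)) xy = independent x∈ y∈ xy
      S-independent (inj₁ (_ , ¬xv)) (inj₂ refl)     xy = ¬xv xy
      S-independent (inj₂ refl)      (inj₁ (y∈ , _)) xy = K-isolated y∈ xy
      S-independent (inj₂ refl)      (inj₂ refl)     xy = loopless refl xy

    pentagonThrough : PentagonThrough v w
    pentagonThrough
      with u , u∉S , ¬abs ← unabsorbed (proj₁ crit) S? S-independent
      with ¬uv ← (λ uv → ¬abs (v , inj₂ refl , uv))
      with u∉K ← (λ u∈ → u∉S (inj₁ (u∈ , ¬uv)))
      with k , k∈ , uk ← absorbent (u∉S ∘ inj₂) u∉K
      with k′ , k′∈ , wk′ ← absorbent (λ { refl → loopless refl vw }) (λ w∈ → K-isolated w∈ vw)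
      -- `k` absorbs `u` in `K` but not in `S`, so it was removed as an in-neighbour of `v`.
      with kv ← decidable-stable (arc? k v) (λ ¬kv → ¬abs (k , inj₁ (k∈ , ¬kv) , uk))
      with ¬k′v ← ¬triangle vw wk′
      = record
        { wk′  = wk′
        -- The walk `u → k → v → w → k′` makes `u` and `k′` adjacent, and `u → k′` is impossible
        -- because `k′` stays in `S`.
        ; k′u  = [ (λ uk′ → contradiction (k′ , inj₁ (k′∈ , ¬k′v) , uk′) ¬abs) , id ]′
                   (walk₄⇒adjacent uk kv vw wk′ (λ { refl → u∉K k′∈ }))
        ; uk   = uk
        ; kv   = kv
        ; ¬uv  = [ ¬uv , ¬triangle uk kv ]′
        ; ¬k′v = [ ¬k′v , K-isolated k′∈ ]′
        ; ¬k′k = [ independent k′∈ k∈ , independent k∈ k′∈ ]′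
        }

  -- The pentagon `a → b → c → x → d → a` with chord `c → d`. The choice between the two routes from
  -- `c` to `d` adjusts walks to length 4.
  module ChordedPentagon {a b c d x} (ab : Arc D a b) (bc : Arc D b c) (cd : Arc D c d)
                         (da : Arc D d a) (cx : Arc D c x) (xd : Arc D x d)
                         (¬ac : ¬ Adjacent D a c) (¬bd : ¬ Adjacent D b d) (¬bx : ¬ Arc D b x) where

    private
      -- The walk `c → d → a → b → y` gives adjacency, and `y → c` would give the walk
      -- `b → y → c → x → d`, making `b` and `d` adjacent.
      arc-from-c : ∀ {y} → Arc D b y → y ≢ c → Arc D c y
      arc-from-c by y≢c with walk₄⇒adjacent cd da ab by (y≢c ∘ sym)
      ... | inj₁ cy = cy
      ... | inj₂ yc = contradiction
        (walk₄⇒adjacent by yc cx xd (λ { refl → asym bc cd })) ¬bd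

      -- The walk `x → d → a → b → y` gives adjacency, and `y → x` would give the walk
      -- `c → y → x → d → a`, making `a` and `c` adjacent.
      arc-from-x : ∀ {y} → Arc D b y → y ≢ c → Arc D x y
      arc-from-x by y≢c with walk₄⇒adjacent xd da ab by (λ { refl → ¬bx by })
      ... | inj₁ xy = xy
      ... | inj₂ yx = contradiction
        (swap (walk₄⇒adjacent (arc-from-c by y≢c) yx xd da (λ { refl → asym cd da }))) ¬ac

      -- The walk `b → c → x → y → z` makes `b` and `z` adjacent, and `z → b` would close a
      -- triangle. The arc `c → y` excludes `z ≡ c`.
      out-closed : ∀ {y z} → Arc D b y → y ≢ c → Arc D y z → Arc D b z × z ≢ c
      out-closed by y≢c yz =
        [ id , (λ zb → contradiction zb (¬triangle by yz)) ]′
          (walk₄⇒adjacent bc cx (arc-from-x by y≢c) yz (λ { refl → asym by yz }))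
        , λ { refl → asym (arc-from-c by y≢c) yz }

    -- Otherwise b has an arc to every vertex reachable from y, against the pentagon through b → y.
    successor-of-b : ∀ {y} → Arc D b y → y ≡ c
    successor-of-b {y} by = decidable-stable (y ≟ c) λ y≢c →
      let bk′ , k′≢c = out-closed by y≢c wk′
          bu  , u≢c  = out-closed bk′ k′≢c k′u
          bk  , _    = out-closed bu u≢c uk
      in asym bk kv
      where open PentagonThrough (pentagonThrough by)

    -- The walk `b → c → x → d → y` gives adjacency, and `b → y` would force `y ≡ c`, against
    -- `c → d`.
    arc-into-b : ∀ {y} → Arc D d y → Arc D y b
    arc-into-b dy with walk₄⇒adjacent bc cx xd dy (λ { refl → ¬bd (inj₂ dy) })
    ... | inj₁ by = contradiction (subst (Arc D d) (successor-of-b by) dy) (asym cd)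
    ... | inj₂ yb = yb

    impossible : ⊥
    impossible = ¬semikernel crit (λ u → (u ≟ b) ⊎-dec (u ≟ d)) (b , inj₁ refl)
      (λ { (inj₁ refl) (inj₁ refl) → loopless refl
         ; (inj₁ refl) (inj₂ refl) → ¬bd ∘ inj₁
         ; (inj₂ refl) (inj₁ refl) → ¬bd ∘ inj₂
         ; (inj₂ refl) (inj₂ refl) → loopless refl })
      (λ { (inj₁ refl) by → d , inj₂ refl , subst (λ y → Arc D y d) (sym (successor-of-b by)) cd
         ; (inj₂ refl) dy → b , inj₁ refl , arc-into-b dy })

  module _ {v w} (vw : Arc D v w) (pentagon : PentagonThrough v w) where

    open PentagonThrough pentagon

    private
      ¬uw : ¬ Arc D u w
      ¬uw uw = ¬triangle uw wk′ k′u

      ¬wk : ¬ Arc D w k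
      ¬wk = ¬triangle kv vw

    pentagonThrough⇒≅C⃗₅ : D ≅ C⃗₅
    pentagonThrough⇒≅C⃗₅ with arc? w u | arc? k w
    -- Both chords close the triangle `w → u → k → w`. With only `w → u` the 4-cycle is
    -- `k → v → w → u → k` and the further vertex `k′`; with only `k → w` it is
    -- `k′ → u → k → w → k′` and `v`.
    ... | yes wu | yes kw = contradiction kw (¬triangle wu uk)
    ... | yes wu | no ¬kw = ⊥-elim (ChordedPentagon.impossible kv vw wu uk wk′ k′u
        [ ¬kw , ¬wk ]′ (¬uv ∘ swap) (¬k′v ∘ inj₂))
    ... | no ¬wu | yes kw = ⊥-elim (ChordedPentagon.impossible k′u uk kw wk′ kv vw
        ¬k′k [ ¬uw , ¬wu ]′ (¬uv ∘ inj₁))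
    ... | no ¬wu | no ¬kw = pentagon⇒≅C⃗₅ asym crit vw wk′ k′u uk kv
        (¬k′v ∘ swap) [ ¬wu , ¬uw ]′ ¬k′k ¬uv [ ¬kw , ¬wk ]′

  arc⇒≅C⃗₅ : ∀ {v w} → Arc D v w → D ≅ C⃗₅
  arc⇒≅C⃗₅ vw = pentagonThrough⇒≅C⃗₅ vw (pentagonThrough vw)

theorem22 : (D : Digraph) → Asymmetrical D → QuasiTransitive 4 D →
    CriticalKernelImperfect D ⇔ (D ≅ A⃗ 3 ≤-refl ⊎ D ≅ C⃗ 5 (s≤s (s≤s z≤n)))
theorem22 D asym quasi = mk⇔ classify
  [ (λ D≅A⃗₃ → critical-resp-≅ D≅A⃗₃ A⃗₃-critical) , (λ D≅C⃗₅ → critical-resp-≅ D≅C⃗₅ C⃗₅-critical) ]′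
  where
  open Digraph D using (arc?)

  classify : CriticalKernelImperfect D → D ≅ A⃗₃ ⊎ D ≅ C⃗₅
  classify crit
    with any? (λ a → any? λ b → any? λ c → arc? a b ×-dec (arc? b c ×-dec arc? c a))
  ... | yes (_ , _ , _ , ab , bc , ca) = inj₁ (triangle⇒≅A⃗₃ asym crit ab bc ca)
  ... | no ¬triangle with any? (λ v → any? (arc? v))
  ...   | yes (_ , _ , vw) = inj₂ (TriangleFree.arc⇒≅C⃗₅ asym quasi crit
            (λ ab bc ca → ¬triangle (_ , _ , _ , ab , bc , ca)) vw)
  -- Without arcs the whole vertex set is independent, and nothing lies outside it.
  ...   | no ¬arc with _ , u∉ , _ ← unabsorbed (proj₁ crit) U? (λ _ _ uv → ¬arc (_ , _ , uv))
            = contradiction tt u∉
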